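{- Let $\mathcal{G}=(V,E,\lambda)$ be a happy compressed temporal graph. If $\mathcal{G}$ is acyclic and temporally connected, then its footprint $(V,E)$ is biconnected, in the sense that it has no cut vertex (no vertex whose removal disconnects the footprint).
   Context: A happy temporal graph is a triple $\mathcal{G}=(V,E,\lambda)$ where $(V,E)$ is a finite simple undirected graph (the footprint) and $\lambda:E\to\{1,2,3,\dots\}$ assigns a single time label to each edge, such that two distinct edges sharing an endpoint have different labels. It is compressed if for every edge $e$ with $\lambda(e)>1$ there is an edge $e'$ adjacent to $e$ with $\lambda(e')=\lambda(e)-1$. A temporal walk is a walk in the footprint along which edge labels are strictly increasing (so no edge is repeated). $\mathcal{G}$ is temporally connected if for all distinct $u,v\in V$ there is a temporal walk from $u$ to $v$. A temporal cycle is a nonempty temporal walk from a vertex to itself; $\mathcal{G}$ is acyclic if it has no temporal cycle. -}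

module Defs where

open import Data.Fin.Base using (Fin)
open import Data.List.Base using (List; []; _∷_)
open import Data.List.Relation.Unary.Linked using (Linked)
open import Data.Nat.Base using (ℕ; suc; _<_; _≤_)
open import Data.Product.Base using (Σ; Σ-syntax; ∃-syntax; _×_)
open import Data.Sum.Base using (_⊎_)
open import Level using (0ℓ)
open import Relation.Binary.Core using (Rel)
open import Relation.Binary.Construct.Closure.ReflexiveTransitive
  using (Star; ε; _◅_)
open import Relation.Binary.Definitions using (Decidable; Irreflexive; Symmetric)
open import Relation.Binary.PropositionalEquality.Core using (_≡_; _≢_)
open import Relation.Nullary.Negation.Core using (¬_)

record SimpleGraph (n : ℕ) : Set₁ where
  field
    Adj    : Rel (Fin n) 0ℓ
    adj?   : Decidable Adj
    sym    : Symmetric Adj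
    irrefl : Irreflexive _≡_ Adj

  Walk : Rel (Fin n) 0ℓ
  Walk = Star Adj

  -- Adjacency in the subgraph induced on the vertices other than c.
  AdjWithout : Fin n → Rel (Fin n) 0ℓ
  AdjWithout c u v = u ≢ c × v ≢ c × Adj u v

  -- Deleting c separates two remaining vertices that were in the same
  -- component; for a connected graph this says that the graph without c is
  -- disconnected.
  CutVertex : Fin n → Set
  CutVertex c = ∃[ u ] ∃[ v ]
    (u ≢ c × v ≢ c × Walk u v × ¬ Star (AdjWithout c) u v)

  -- Connectedness is not part of this notion.
  Biconnected : Set
  Biconnected = ¬ (∃[ c ] CutVertex c)

record TemporalGraph (n : ℕ) : Set₁ where
  field
    footprint : SimpleGraph n

  open SimpleGraph footprint public

  field
    label     : ∀ {u v} → Adj u v → ℕ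
    label-pos : ∀ {u v} (e : Adj u v) → 1 ≤ label e
    -- The label belongs to the undirected edge {u , v}.  Together with sym
    -- this also makes it independent of the proof of adjacency.
    label-sym : ∀ {u v} (e : Adj u v) (e′ : Adj v u) → label e ≡ label e′

  -- Two distinct edges that share an endpoint u have distinct other endpoints.
  Happy : Set
  Happy = ∀ {u v w} (e : Adj u v) (e′ : Adj u w) → v ≢ w → label e ≢ label e′

  -- The edge e′ shares the endpoint u or the endpoint v with e.  It is
  -- distinct from e because its label is.
  Compressed : Set
  Compressed = ∀ {u v} (e : Adj u v) → 1 < label e →
    ∃[ w ] ((Σ[ e′ ∈ Adj u w ] suc (label e′) ≡ label e)
          ⊎ (Σ[ e′ ∈ Adj v w ] suc (label e′) ≡ label e))

  labels : ∀ {u v} → Walk u v → List ℕ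
  labels ε       = []
  labels (e ◅ p) = label e ∷ labels p

  Temporal : ∀ {u v} → Walk u v → Set
  Temporal p = Linked _<_ (labels p)

  TemporallyConnected : Set
  TemporallyConnected = ∀ {u v} → u ≢ v → Σ (Walk u v) Temporal

  TemporalCycle : Set
  TemporalCycle = ∃[ v ] Σ[ p ∈ Walk v v ] (p ≢ ε × Temporal p)

  Acyclic : Set
  Acyclic = ¬ TemporalCycle

{-# OPTIONS --safe #-}

-- Let y be the neighbour of c along the edge of largest label M at c.  A
-- temporal walk from y which passes through c and goes on reaches c at a time
-- smaller than M, hence could return from c to y at time M, closing a temporal
-- cycle.  So the temporal walks from y to the vertices other than c avoid c,
-- and the graph without c is connected.
module Submission where

open import Defs
open import Data.Fin.Base using (Fin)
open import Data.Fin.Properties using (_≟_)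
open import Data.List.Base using (_∷_; allFin)
open import Data.List.Extrema.Nat using (argmax; f[xs]≤f[argmax])
open import Data.List.Membership.Propositional.Properties using (∈-allFin)
open import Data.List.Relation.Unary.All using (lookup)
open import Data.List.Relation.Unary.Linked using ([-]; _∷_)
import Data.List.Relation.Unary.Linked as Linked
open import Data.Nat.Base using (ℕ; _<_; _≤_)
open import Data.Nat.Properties using (<-≤-trans; ≤-trans; ≤-reflexive; n≮0)
open import Data.Product.Base using (Σ-syntax; ∃-syntax; _,_)
open import Data.Sum.Base using (_⊎_; inj₁; inj₂)
open import Relation.Binary.Construct.Closure.ReflexiveTransitive
  using (Star; ε; _◅_; _◅◅_; reverse)
open import Relation.Binary.PropositionalEquality.Core
  using (_≡_; _≢_; refl; sym; trans)
open import Relation.Nullary.Decidable.Core using (Dec; yes; no)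
open import Relation.Nullary.Negation.Core using (contradiction)

module _ {n : ℕ} (G : TemporalGraph n) where
  open TemporalGraph G renaming (sym to Adj-sym)

  -- The proof of adjacency returned by `adj?` need not be the one at hand.
  label-irrelevant : ∀ {u v} (e e′ : Adj u v) → label e ≡ label e′
  label-irrelevant e e′ =
    trans (label-sym e (Adj-sym e)) (sym (label-sym e′ (Adj-sym e)))

  AdjWithout-sym : ∀ {c u v} → AdjWithout c u v → AdjWithout c v u
  AdjWithout-sym (u≢c , v≢c , e) = v≢c , u≢c , Adj-sym e

  Latest : ∀ {c y} → Adj c y → Set
  Latest {c} e = ∀ {w} (e′ : Adj c w) → label e′ ≤ label e

  latestEdge : ∀ {c x} → Adj c x → ∃[ y ] Σ[ e ∈ Adj c y ] Latest e
  latestEdge {c} {x} e₀ = y , edge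
    where
    -- The junk value 0 lies below every label.
    labelOr0 : ∀ {w} → Dec (Adj c w) → ℕ
    labelOr0 (yes e) = label e
    labelOr0 (no _)  = 0

    f : Fin n → ℕ
    f w = labelOr0 (adj? c w)

    label≤f : ∀ {w} (e : Adj c w) → label e ≤ f w
    label≤f {w} e with adj? c w
    ... | yes e′ = ≤-reflexive (label-irrelevant e e′)
    ... | no ¬e  = contradiction e ¬e

    y : Fin n
    y = argmax f x (allFin n)

    label≤f[y] : ∀ {w} (e : Adj c w) → label e ≤ f y
    label≤f[y] {w} e =
      ≤-trans (label≤f e) (lookup (f[xs]≤f[argmax] x (allFin n)) (∈-allFin w))

    edge : Σ[ e ∈ Adj c y ] Latest e
    -- Abstracting the bound together with `adj? c y` lets `f y` reduce in its type. In the `no`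
    -- case the positive label of `e₀` would be at most the junk value 0.
    edge with adj? c y | label≤f[y]
    ... | yes e | label≤ = e , label≤
    ... | no _  | label≤ = contradiction (≤-trans (label-pos e₀) (label≤ e₀)) n≮0

  -- Exhibiting the first edge excludes the empty walk, a temporal cycle needing one edge.
  TemporalAfter : ℕ → Fin n → Fin n → Set
  TemporalAfter t x y =
    ∃[ z ] Σ[ e ∈ Adj x z ] Σ[ p ∈ Walk z y ] Linked.Linked _<_ (t ∷ labels (e ◅ p))

  -- Induction on the walk up to its first visit to `c`. The bound `t` stands for the label of the
  -- preceding edge, so that a returning walk found later can be prolonged backwards by `e₁`.
  avoids-or-returns : ∀ {c y} {e : Adj c y} → Latest e →
    ∀ {t x b} → x ≢ c → b ≢ c →
    (p : Walk x b) → Linked.Linked _<_ (t ∷ labels p) →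
    Star (AdjWithout c) x b ⊎ TemporalAfter t x y
  avoids-or-returns latest x≢c b≢c ε _ = inj₁ ε
  avoids-or-returns {c} latest x≢c b≢c (_◅_ {j = z} e₁ p) (t< ∷ inc) with z ≟ c
  avoids-or-returns latest x≢c b≢c (e₁ ◅ ε) (t< ∷ inc) | yes refl =
    contradiction refl b≢c
  -- The walk enters `c` by `e₁` and leaves by `e₂`. As `label e₁ < label e₂ ≤ label e`, the edge
  -- `e` to `y` can take the place of `e₂ ◅ p`.
  avoids-or-returns {e = e} latest x≢c b≢c (e₁ ◅ (e₂ ◅ p)) (t< ∷ (e₁<e₂ ∷ _)) | yes refl =
    inj₂ (_ , e₁ , e ◅ ε , t< ∷ <-≤-trans e₁<e₂ (latest e₂) ∷ [-])
  ... | no z≢c with avoids-or-returns latest z≢c b≢c p inc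
  ...   | inj₁ q                = inj₁ ((x≢c , z≢c , e₁) ◅ q)
  ...   | inj₂ (_ , e₂ , q , inc′) = inj₂ (_ , e₁ , e₂ ◅ q , t< ∷ inc′)

  temporal-after-0 : ∀ {x b} (p : Walk x b) → Temporal p →
    Linked.Linked _<_ (0 ∷ labels p)
  temporal-after-0 ε       _   = [-]
  temporal-after-0 (e ◅ p) inc = label-pos e ∷ inc

  latest-reaches : Acyclic → TemporallyConnected →
    ∀ {c y} {e : Adj c y} → Latest e →
    ∀ {b} → b ≢ c → Star (AdjWithout c) y b
  latest-reaches acyclic connected {y = y} {e} latest {b} b≢c with y ≟ b
  ... | yes refl = ε
  ... | no y≢b with connected y≢b
  ...   | p , inc with avoids-or-returns latest y≢c b≢c p (temporal-after-0 p inc)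
    where
    y≢c : y ≢ _
    y≢c y≡c = irrefl (sym y≡c) e
  ...     | inj₁ q = q
  -- Here the start is `y` itself, so the returning walk is closed; dropping the bound 0 leaves a
  -- temporal cycle.
  ...     | inj₂ (_ , e₁ , q , inc′) =
    contradiction (_ , e₁ ◅ q , (λ ()) , Linked.tail inc′) acyclic

  no-cut-vertex : Acyclic → TemporallyConnected → Biconnected
  no-cut-vertex acyclic connected (c , u , v , u≢c , v≢c , _ , separated)
    -- The first edge of a walk from `c` to `u` shows that `c` is not isolated, so it has a latest
    -- edge.
    with connected (λ c≡u → u≢c (sym c≡u))
  ... | ε , _      = u≢c refl
  ... | e₀ ◅ _ , _ with latestEdge e₀
  ...   | _ , _ , latest =
    -- The two walks are joined at `y`, the far end of that latest edge.
    separated (reverse AdjWithout-sym (reaches u≢c) ◅◅ reaches v≢c)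
    where
    reaches : ∀ {b} → b ≢ c → Star (AdjWithout c) _ b
    reaches = latest-reaches acyclic connected latest

lemma3p7 : ∀ (n : ℕ) (G : TemporalGraph n) →
    TemporalGraph.Happy G →
    TemporalGraph.Compressed G →
    TemporalGraph.Acyclic G →
    TemporalGraph.TemporallyConnected G →
    SimpleGraph.Biconnected (TemporalGraph.footprint G)
lemma3p7 n G _ _ = no-cut-vertex G
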